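{- For a positive integer $n$, there exists a loop $Q$ of order $n$ satisfying $P(Q)=Q$ if and only if $n=1$ or $n\ge 5$.
   Context: A quasigroup is a set $Q$ with a binary operation $\cdot$ such that for all $a,b\in Q$ the equations $ax=b$ and $ya=b$ have unique solutions $x,y\in Q$. A loop is a quasigroup with a two-sided neutral element. For a finite loop $Q$, $P(Q)$ denotes the set of all elements of $Q$ that can be obtained as a product of all the elements of $Q$, each used exactly once, in some order and with some bracketing. -}

module Defs where

open import Data.Nat using (ℕ)
open import Data.Fin using (Fin)
open import Data.List using (List; []; _∷_; _++_)
open import Data.List.Relation.Binary.Permutation.Propositional using (_↭_)
open import Data.Product using (∃; ∃!; _×_)
open import Relation.Binary.PropositionalEquality using (_≡_)

-- A loop of order n, presented on the carrier Fin n (every loop of order n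
-- is isomorphic to one of these).
record Loop (n : ℕ) : Set where
  field
    _·_ : Fin n → Fin n → Fin n
    e   : Fin n
    left-div  : ∀ a b → ∃! _≡_ (λ x → a · x ≡ b)
    right-div : ∀ a b → ∃! _≡_ (λ y → y · a ≡ b)
    identityˡ : ∀ x → e · x ≡ x
    identityʳ : ∀ x → x · e ≡ x

data Bracketing {n : ℕ} : Set where
  leaf : Fin n → Bracketing
  node : Bracketing {n} → Bracketing {n} → Bracketing

leaves : ∀ {n} → Bracketing {n} → List (Fin n)
leaves (leaf a)   = a ∷ []
leaves (node l r) = leaves l ++ leaves r

eval : ∀ {n} → Loop n → Bracketing {n} → Fin n
eval Q (leaf a)   = a
eval Q (node l r) = Loop._·_ Q (eval Q l) (eval Q r)

open import Data.List using (allFin)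

InP : ∀ {n} → Loop n → Fin n → Set
InP {n} Q q = ∃ λ (t : Bracketing {n}) → (leaves t ↭ allFin n) × (eval Q t ≡ q)

PIsWhole : ∀ {n} → Loop n → Set
PIsWhole {n} Q = ∀ (q : Fin n) → InP Q q

{-# OPTIONS --safe #-}

-- Loops of order 2, 3 and 4 are abelian groups, where the product of all
-- elements does not depend on order or bracketing.  Conversely, order 5 is
-- settled by a table, and for m = n - 1 ≥ 5 put a loop on {e} ∪ ℤ/m in which all
-- translations of ℤ/m are automorphisms: x · y = x + f (y - x), except that
-- x · (x + c) = e for one fixed c.  By translation invariance P(Q) = Q as soon as
-- P(Q) contains e and some residue, which only needs a few small blocks of
-- residues with product e.  For odd m take c = 0 and f(d) = d/2; for m = 2c take
-- f(d) = 2d + 1 for d < c and f(d) = 2d for d > c.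
module Submission where

open import Defs
open import Data.Nat using (ℕ; _≤_)
open import Data.Product using (∃)
open import Data.Sum using (_⊎_)
open import Function.Bundles using (_⇔_)
open import Relation.Binary.PropositionalEquality using (_≡_)

open import Algebra.Structures using (IsCommutativeMonoid)
open import Data.Fin using (Fin; zero; suc; toℕ; fromℕ<; punchOut)
open import Data.Fin.Patterns using (0F; 1F; 2F; 3F; 4F)
open import Data.Fin.Properties using
  (all?; any?; _≟_; suc-injective; toℕ-fromℕ<; toℕ-injective; toℕ<n; punchOut-injective; injective⇒≤)
open import Data.Integer as ℤ using (ℤ; +_; 0ℤ; 1ℤ; _+_; _-_; _*_; -_)
open import Data.Integer.DivMod using (_%ℕ_; _/ℕ_; n%ℕd<d; a≡a%ℕn+[a/ℕn]*n)
open import Data.Integer.Divisibility.Signed using (_∣_; divides; ∣⇒∣ᵤ; ∣n⇒∣m*n; ∣m∣n⇒∣m+n)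
import Data.Integer.Properties as ℤ
open import Data.Integer.Tactic.RingSolver using (solve-∀)
open import Data.List using (List; []; _∷_; _++_; allFin; foldr; map; tabulate)
open import Data.List.Properties using (map-tabulate; map-++)
open import Data.List.Relation.Binary.Permutation.Propositional using
  (_↭_; ↭-refl; ↭-reflexive; ↭-sym; ↭-trans; ↭⇒↭ₛ; prep; swap; module PermutationReasoning)
open import Data.List.Relation.Binary.Permutation.Propositional.Properties using
  (++-comm; ++⁺; drop-∷; shift; map⁺)
open import Data.List.Relation.Binary.Permutation.Setoid.Properties using (foldr-commMonoid)
open import Data.Nat as ℕ using (zero; suc; NonZero; _<_; z≤n; s≤s)
import Data.Nat.Divisibility as ℕ
import Data.Nat.Properties as ℕ
import Data.Nat.Tactic.RingSolver as ℕ-Solver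
open import Data.Product using (∃!; _×_; _,_; proj₁; proj₂)
open import Data.Sum using (inj₁; inj₂)
open import Data.Vec as Vec using (Vec; []; _∷_)
open import Data.Vec.Properties using (lookup∘tabulate)
open import Function using (_∘_; case_of_; id)
open import Function.Bundles using (mk⇔)
open import Level using (0ℓ)
open import Relation.Binary.Bundles using (Setoid)
open import Relation.Binary.Definitions using (tri<; tri≈; tri>)
open import Relation.Binary.PropositionalEquality using
  (_≢_; refl; sym; trans; cong; cong₂; subst; subst₂; setoid; isEquivalence; module ≡-Reasoning)
import Relation.Binary.Reasoning.Setoid as ≈-Reasoning
open import Relation.Nullary using (¬_; Dec; yes; no; contradiction)
open import Relation.Nullary.Decidable using (map′; _×-dec_; _→-dec_; toWitness)

-- Loops of order at most 4

Exhaustible : Set → Set₁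
Exhaustible A = ∀ {P : A → Set} → (∀ a → Dec (P a)) → Dec (∀ a → P a)

Vec-exhaustible : ∀ {A k} → Exhaustible A → Exhaustible (Vec A k)
Vec-exhaustible {k = zero}  A? P? =
  map′ (λ { p [] → p }) (λ f → f []) (P? [])
Vec-exhaustible {k = suc k} A? P? =
  map′ (λ { f (x ∷ xs) → f x xs }) (λ f x xs → f (x ∷ xs))
    (A? λ x → Vec-exhaustible A? (P? ∘ (x ∷_)))

-- Rejecting a partial vector at its first bad entry keeps the search small.
constrained? : ∀ {A k} → Exhaustible A → {Ok : Fin k → A → Set} {P : Vec A k → Set} →
  (∀ i a → Dec (Ok i a)) → (∀ v → Dec (P v)) →
  Dec (∀ v → (∀ i → Ok i (Vec.lookup v i)) → P v)
constrained? {k = zero} A? Ok? P? =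
  map′ (λ { p [] _ → p }) (λ f → f [] λ ()) (P? [])
constrained? {k = suc k} A? Ok? P? =
  map′ (λ { f (x ∷ xs) ok → f x (ok zero) xs (ok ∘ suc) })
       (λ f x ok₀ xs ok → f (x ∷ xs) λ { zero → ok₀ ; (suc i) → ok i })
    (A? λ x → Ok? zero x →-dec constrained? A? (Ok? ∘ suc) (P? ∘ (x ∷_)))

-- Vectors of rows instead of functions, so that quantification over all multiplication tables can
-- be decided by recursion on the entries.
Table : ℕ → Set
Table n = Vec (Vec (Fin n) n) n

mul : ∀ {n} → Table n → Fin n → Fin n → Fin n
mul t a b = Vec.lookup (Vec.lookup t a) b

module _ {n : ℕ} (e : Fin n) where

  -- The part of the loop axioms that involves row `a` alone: both identity laws and left
  -- cancellation. A row violating them is discarded before the next row is chosen; right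
  -- cancellation compares different rows and waits for the full table.
  LoopRow : Fin n → Vec (Fin n) n → Set
  LoopRow a r = Vec.lookup r e ≡ a
              × (a ≡ e → ∀ x → Vec.lookup r x ≡ x)
              × (∀ x y → Vec.lookup r x ≡ Vec.lookup r y → x ≡ y)

  LoopRow? : ∀ a r → Dec (LoopRow a r)
  LoopRow? a r =
    (Vec.lookup r e ≟ a)
    ×-dec ((a ≟ e) →-dec all? λ x → Vec.lookup r x ≟ x)
    ×-dec (all? λ x → all? λ y → (Vec.lookup r x ≟ Vec.lookup r y) →-dec (x ≟ y))

module _ {n : ℕ} where

  ColumnsCancel : Table n → Set
  ColumnsCancel t = ∀ a x y → mul t x a ≡ mul t y a → x ≡ y

  CommAssoc : Table n → Set
  CommAssoc t = (∀ x y → mul t x y ≡ mul t y x)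
              × (∀ x y z → mul t (mul t x y) z ≡ mul t x (mul t y z))

  columnsCancel⇒commAssoc? : ∀ t → Dec (ColumnsCancel t → CommAssoc t)
  columnsCancel⇒commAssoc? t =
    (all? λ a → all? λ x → all? λ y → (mul t x a ≟ mul t y a) →-dec (x ≟ y))
    →-dec
    ((all? λ x → all? λ y → mul t x y ≟ mul t y x)
     ×-dec
     (all? λ x → all? λ y → all? λ z → mul t (mul t x y) z ≟ mul t x (mul t y z)))

-- Holds for orders 2, 3 and 4, where it is decided by search. The neutral element is quantified as
-- well, since a loop on `Fin n` may have it anywhere.
LoopTablesAbelian : ℕ → Set
LoopTablesAbelian n = ∀ (e : Fin n) (t : Table n) →
  (∀ a → LoopRow e a (Vec.lookup t a)) → ColumnsCancel t → CommAssoc t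

loopTablesAbelian? : ∀ n → Dec (LoopTablesAbelian n)
loopTablesAbelian? n = all? λ e →
  constrained? (Vec-exhaustible all?) (LoopRow? e) columnsCancel⇒commAssoc?

uniqueDiv⇒injective : ∀ {n} {f : Fin n → Fin n} →
  (∀ b → ∃! _≡_ (λ x → f x ≡ b)) → ∀ {x y} → f x ≡ f y → x ≡ y
uniqueDiv⇒injective {f = f} div {x} {y} eq =
  let (_ , _ , unique) = div (f y) in trans (sym (unique eq)) (unique refl)

-- Products in abelian loops

module _ {n : ℕ} (abelian : LoopTablesAbelian n) (Q : Loop n) where
  open Loop Q

  private
    t : Table n
    t = Vec.tabulate λ a → Vec.tabulate (a ·_)

    mul-t : ∀ a b → mul t a b ≡ a · b
    mul-t a b = trans (cong (λ r → Vec.lookup r b) (lookup∘tabulate _ a)) (lookup∘tabulate _ b)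

    commAssoc : CommAssoc t
    commAssoc = abelian e t
      (λ a → trans (mul-t a e) (identityʳ a)
           , (λ { refl x → trans (mul-t a x) (identityˡ x) })
           , λ x y eq → uniqueDiv⇒injective (left-div a)
                          (trans (sym (mul-t a x)) (trans eq (mul-t a y))))
      (λ a x y eq → uniqueDiv⇒injective (right-div a)
                      (trans (sym (mul-t x a)) (trans eq (mul-t y a))))

    ·-comm : ∀ x y → x · y ≡ y · x
    ·-comm x y = trans (sym (mul-t x y)) (trans (proj₁ commAssoc x y) (mul-t y x))

    ·-assoc : ∀ x y z → (x · y) · z ≡ x · (y · z)
    ·-assoc x y z = begin
      (x · y) · z            ≡⟨ cong (_· z) (mul-t x y) ⟨
      mul t x y · z          ≡⟨ mul-t _ z ⟨
      mul t (mul t x y) z    ≡⟨ proj₂ commAssoc x y z ⟩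
      mul t x (mul t y z)    ≡⟨ mul-t x _ ⟩
      x · mul t y z          ≡⟨ cong (x ·_) (mul-t y z) ⟩
      x · (y · z)            ∎
      where open ≡-Reasoning

    isCommutativeMonoid : IsCommutativeMonoid _≡_ _·_ e
    isCommutativeMonoid = record
      { isMonoid = record
        { isSemigroup = record
          { isMagma = record { isEquivalence = isEquivalence ; ∙-cong = cong₂ _·_ }
          ; assoc = ·-assoc }
        ; identity = identityˡ , identityʳ }
      ; comm = ·-comm }

    foldr-++ : ∀ xs ys → foldr _·_ e (xs ++ ys) ≡ foldr _·_ e xs · foldr _·_ e ys
    foldr-++ []       ys = sym (identityˡ _)
    foldr-++ (x ∷ xs) ys = trans (cong (x ·_) (foldr-++ xs ys)) (sym (·-assoc x _ _))

    eval≡foldr : ∀ t → eval Q t ≡ foldr _·_ e (leaves t)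
    eval≡foldr (leaf a)   = sym (identityʳ a)
    eval≡foldr (node l r) =
      trans (cong₂ _·_ (eval≡foldr l) (eval≡foldr r)) (sym (foldr-++ (leaves l) (leaves r)))

  -- By associativity every bracketing evaluates to the fold of its leaves, and by commutativity the
  -- fold is the same for every ordering of all elements.
  InP-unique : ∀ {p q} → InP Q p → InP Q q → p ≡ q
  InP-unique p∈P q∈P = trans (product p∈P) (sym (product q∈P))
    where
    product : ∀ {q} → InP Q q → q ≡ foldr _·_ e (allFin n)
    product (t , ↭ , refl) =
      trans (eval≡foldr t) (foldr-commMonoid (setoid (Fin n)) isCommutativeMonoid (↭⇒↭ₛ ↭))

abelian⇒¬PIsWhole : ∀ {n} → LoopTablesAbelian (suc (suc n)) → (Q : Loop (suc (suc n))) → ¬ PIsWhole Q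
abelian⇒¬PIsWhole abelian Q whole =
  case InP-unique abelian Q (whole zero) (whole (suc zero)) of λ ()

-- Residues modulo m

module Residues (m : ℕ) .{{_ : NonZero m}} where

  infix 4 _≈_
  record _≈_ (i j : ℤ) : Set where
    constructor congruent
    field modulus∣difference : + m ∣ i - j

  -- The workhorse for congruences: if `i - j` is an integer multiple of a difference already known
  -- to vanish modulo `m`, only a ring identity over ℤ is left, which the solver proves.
  ≈-by : ∀ {a b} i j t → i - j ≡ t * (a - b) → a ≈ b → i ≈ j
  ≈-by i j t eq (congruent a≈b) = congruent (subst (+ m ∣_) (sym eq) (∣n⇒∣m*n t a≈b))

  ≈-reflexive : ∀ {i j} → i ≡ j → i ≈ j
  ≈-reflexive {i} refl = congruent (divides 0ℤ (ℤ.+-inverseʳ i))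

  ≈-refl : ∀ {i} → i ≈ i
  ≈-refl = ≈-reflexive refl

  ≈-sym : ∀ {i j} → i ≈ j → j ≈ i
  ≈-sym {i} {j} = ≈-by j i (- 1ℤ) (lemma i j)
    where
    lemma : ∀ i j → j - i ≡ - 1ℤ * (i - j)
    lemma = solve-∀

  ≈-trans : ∀ {i j k} → i ≈ j → j ≈ k → i ≈ k
  ≈-trans {i} {j} {k} (congruent p) (congruent q) =
    congruent (subst (+ m ∣_) (lemma i j k) (∣m∣n⇒∣m+n p q))
    where
    lemma : ∀ i j k → (i - j) + (j - k) ≡ i - k
    lemma = solve-∀

  ≈-setoid : Setoid 0ℓ 0ℓ
  ≈-setoid = record
    { _≈_ = _≈_
    ; isEquivalence = record { refl = ≈-refl ; sym = ≈-sym ; trans = ≈-trans } }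

  +-cong : ∀ {i j k l} → i ≈ j → k ≈ l → i + k ≈ j + l
  +-cong {i} {j} {k} {l} (congruent p) (congruent q) =
    congruent (subst (+ m ∣_) (lemma i j k l) (∣m∣n⇒∣m+n p q))
    where
    lemma : ∀ i j k l → (i - j) + (k - l) ≡ (i + k) - (j + l)
    lemma = solve-∀

  *-congˡ : ∀ k {i j} → i ≈ j → k * i ≈ k * j
  *-congˡ k {i} {j} = ≈-by _ _ k (lemma k i j)
    where
    lemma : ∀ k i j → k * i - k * j ≡ k * (i - j)
    lemma = solve-∀

  neg-cong : ∀ {i j} → i ≈ j → - i ≈ - j
  neg-cong {i} {j} = ≈-by _ _ (- 1ℤ) (lemma i j)
    where
    lemma : ∀ i j → - i - - j ≡ - 1ℤ * (i - j)
    lemma = solve-∀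

  +-cancelˡ : ∀ k {i j} → k + i ≈ k + j → i ≈ j
  +-cancelˡ k {i} {j} = ≈-by _ _ 1ℤ (lemma k i j)
    where
    lemma : ∀ k i j → i - j ≡ 1ℤ * ((k + i) - (k + j))
    lemma = solve-∀

  modulus≈0 : + m ≈ 0ℤ
  modulus≈0 = congruent (divides 1ℤ (lemma (+ m)))
    where
    lemma : ∀ x → x - 0ℤ ≡ 1ℤ * x
    lemma = solve-∀

  -- The modulus divides the distance of `a` and `b`, which is less than `m` and hence zero.
  +-injective-≈ : ∀ {a b} → a < m → b < m → + a ≈ + b → a ≡ b
  +-injective-≈ {a} {b} a<m b<m (congruent a≈b) =
    ℤ.+-injective (ℤ.i-j≡0⇒i≡j (+ a) (+ b) (ℤ.∣i∣≡0⇒i≡0 (multiple<m (∣⇒∣ᵤ a≈b) distance<m)))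
    where
    multiple<m : ∀ {k} → m ℕ.∣ k → k < m → k ≡ 0
    multiple<m {zero}  _   _   = refl
    multiple<m {suc k} m∣k k<m = contradiction m∣k (ℕ.>⇒∤ k<m)

    distance<m : ℤ.∣ + a - + b ∣ < m
    distance<m = subst (λ i → ℤ.∣ i ∣ < m) (sym (ℤ.m-n≡m⊖n a b))
      (ℕ.≤-<-trans (ℤ.∣m⊝n∣≤m⊔n a b) (ℕ.⊔-lub a<m b<m))

  ≉-by : ∀ {i j} a → j - i ≡ + suc a → suc a < m → ¬ i ≈ j
  ≉-by {i} {j} a j-i≡ a<m i≈j = case +-injective-≈ a<m (ℕ.≤-<-trans z≤n a<m)
      (≈-by (+ suc a) 0ℤ (- 1ℤ) (trans (cong (_- 0ℤ) (sym j-i≡)) (lemma i j)) i≈j) of λ ()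
    where
    lemma : ∀ i j → (j - i) - 0ℤ ≡ - 1ℤ * (i - j)
    lemma = solve-∀

  ι : Fin m → ℤ
  ι x = + toℕ x

  -- Opaque so that i can be inferred from [ i ].
  opaque
    [_] : ℤ → Fin m
    [ i ] = fromℕ< (n%ℕd<d i m)

    ι[] : ∀ i → ι [ i ] ≈ i
    ι[] i = congruent (divides (- (i /ℕ m)) (begin
      ι [ i ] - i                       ≡⟨ cong (λ r → + r - i) (toℕ-fromℕ< _) ⟩
      + (i %ℕ m) - i                    ≡⟨ cong (λ k → + (i %ℕ m) - k) (a≡a%ℕn+[a/ℕn]*n i m) ⟩
      + (i %ℕ m) - (+ (i %ℕ m) + (i /ℕ m) * + m) ≡⟨ lemma (+ (i %ℕ m)) (i /ℕ m) (+ m) ⟩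
      - (i /ℕ m) * + m                  ∎))
      where
      open ≡-Reasoning
      lemma : ∀ r q n → r - (r + q * n) ≡ - q * n
      lemma = solve-∀

  ι-injective : ∀ {x y} → ι x ≈ ι y → x ≡ y
  ι-injective {x} {y} = toℕ-injective ∘ +-injective-≈ (toℕ<n x) (toℕ<n y)

  []-cong : ∀ {i j} → i ≈ j → [ i ] ≡ [ j ]
  []-cong {i} {j} i≈j = ι-injective (≈-trans (ι[] i) (≈-trans i≈j (≈-sym (ι[] j))))

  []-injective : ∀ {i j} → [ i ] ≡ [ j ] → i ≈ j
  []-injective {i} {j} eq =
    ≈-trans (≈-sym (ι[] i)) (≈-trans (≈-reflexive (cong ι eq)) (ι[] j))

  [ι] : ∀ x → [ ι x ] ≡ x
  [ι] x = ι-injective (ι[] (ι x))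

  segment : ℤ → ℕ → List (Fin m)
  segment s zero    = []
  segment s (suc l) = [ s ] ∷ segment (s + 1ℤ) l

  segment-++ : ∀ s a b → segment s (a ℕ.+ b) ≡ segment s a ++ segment (s + + a) b
  segment-++ s zero    b = cong (λ s → segment s b) (sym (ℤ.+-identityʳ s))
  segment-++ s (suc a) b = cong ([ s ] ∷_) (trans (segment-++ (s + 1ℤ) a b)
    (cong (λ t → segment (s + 1ℤ) a ++ segment t b) (ℤ.+-assoc s 1ℤ (+ a))))

  tabulate≡segment : ∀ s l (f : Fin l → Fin m) →
    (∀ k → f k ≡ [ s + + toℕ k ]) → tabulate f ≡ segment s l
  tabulate≡segment s zero    f eq = refl
  tabulate≡segment s (suc l) f eq = cong₂ _∷_
    (trans (eq zero) (cong [_] (ℤ.+-identityʳ s)))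
    (tabulate≡segment (s + 1ℤ) l (f ∘ suc) λ k →
      trans (eq (suc k)) (cong [_] (sym (ℤ.+-assoc s 1ℤ _))))

  segment-cong : ∀ {s t} l → s ≈ t → segment s l ≡ segment t l
  segment-cong zero    s≈t = refl
  segment-cong (suc l) s≈t = cong₂ _∷_ ([]-cong s≈t) (segment-cong l (+-cong s≈t (≈-refl {1ℤ})))

  -- Prepending `[ s ]` to the left side gives the segment of length `m + 1` from `s`, whose last
  -- entry is again `[ s ]` because `s + m` is congruent to `s`. Cancelling one copy leaves the
  -- claim.
  segment-rotate : ∀ s → segment (s + 1ℤ) m ↭ segment s m
  segment-rotate s = drop-∷ (begin
    segment s (suc m)               ≡⟨ cong (segment s) (ℕ.+-comm 1 m) ⟩
    segment s (m ℕ.+ 1)             ≡⟨ segment-++ s m 1 ⟩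
    segment s m ++ [ s + + m ] ∷ [] ≡⟨ cong (λ x → segment s m ++ x ∷ []) ([]-cong s+m≈s) ⟩
    segment s m ++ [ s ] ∷ []       ↭⟨ ++-comm (segment s m) _ ⟩
    [ s ] ∷ segment s m             ∎)
    where
    open PermutationReasoning
    s+m≈s : s + + m ≈ s
    s+m≈s = ≈-trans (+-cong (≈-refl {s}) modulus≈0) (≈-reflexive (ℤ.+-identityʳ s))

  -- Replace `s` by its natural representative and rotate down to the start 0.
  segment↭allFin : ∀ s → segment s m ↭ allFin m
  segment↭allFin s = begin
    segment s m             ≡⟨ segment-cong m (≈-sym (ι[] s)) ⟩
    segment (ι [ s ]) m     ↭⟨ rotations (toℕ [ s ]) ⟩
    segment 0ℤ m            ≡⟨ tabulate≡segment 0ℤ m _ (λ k → sym (trans (cong [_] (ℤ.+-identityˡ (ι k))) ([ι] k))) ⟨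
    allFin m                ∎
    where
    open PermutationReasoning
    rotations : ∀ k → segment (+ k) m ↭ segment 0ℤ m
    rotations zero    = ↭-refl
    rotations (suc k) = begin
      segment (+ suc k) m      ≡⟨ cong (λ k → segment (+ k) m) (ℕ.+-comm 1 k) ⟩
      segment (+ k + 1ℤ) m     ↭⟨ segment-rotate (+ k) ⟩
      segment (+ k) m          ↭⟨ rotations k ⟩
      segment 0ℤ m             ∎

-- Loops on {e} ∪ ℤ/m

-- Pigeonhole: if `b` were missed, punching it out would give an injection from `Fin (suc n)` into
-- `Fin n`.
injective⇒strictlySurjective : ∀ {n} {f : Fin n → Fin n} →
  (∀ {x y} → f x ≡ f y → x ≡ y) → ∀ b → ∃ λ x → f x ≡ b
injective⇒strictlySurjective {suc n} {f} inj b with any? (λ x → f x ≟ b)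
... | yes hit = hit
... | no miss = contradiction
  (injective⇒≤ {f = λ x → punchOut (avoids x)}
    (λ {x} {y} eq → inj (punchOut-injective (avoids x) (avoids y) eq)))
  (ℕ.<⇒≱ ℕ.≤-refl)
  where
  avoids : ∀ x → b ≢ f x
  avoids x eq = miss (x , sym eq)

injective⇒uniqueDiv : ∀ {n} {f : Fin n → Fin n} →
  (∀ {x y} → f x ≡ f y → x ≡ y) → ∀ b → ∃! _≡_ (λ x → f x ≡ b)
injective⇒uniqueDiv inj b =
  let (x , fx≡b) = injective⇒strictlySurjective inj b
  in x , fx≡b , λ fy≡b → inj (trans fx≡b (sym fy≡b))

-- On a finite carrier the cancellation laws make all translations bijective, which is unique
-- divisibility.
cancellativeLoop : ∀ {n} (_·_ : Fin n → Fin n → Fin n) (e : Fin n) →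
  (∀ a {x y} → a · x ≡ a · y → x ≡ y) →
  (∀ a {x y} → x · a ≡ y · a → x ≡ y) →
  (∀ x → e · x ≡ x) → (∀ x → x · e ≡ x) → Loop n
cancellativeLoop _·_ e cancelˡ cancelʳ idˡ idʳ = record
  { _·_ = _·_ ; e = e
  ; left-div  = λ a → injective⇒uniqueDiv (cancelˡ a)
  ; right-div = λ a → injective⇒uniqueDiv (cancelʳ a)
  ; identityˡ = idˡ ; identityʳ = idʳ }

-- Products over prescribed lists of factors

module Products {n} (Q : Loop n) where
  open Loop Q

  -- `InP` with an arbitrary list in place of `allFin n`, so that products of all elements can be
  -- assembled from products of blocks.
  Product : List (Fin n) → Fin n → Set
  Product xs q = ∃ λ (t : Bracketing {n}) → (leaves t ↭ xs) × (eval Q t ≡ q)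

  single : ∀ a → Product (a ∷ []) a
  single a = leaf a , ↭-refl , refl

  infixr 7 _⊙_
  _⊙_ : ∀ {xs ys a b} → Product xs a → Product ys b → Product (xs ++ ys) (a · b)
  (t , t↭ , refl) ⊙ (u , u↭ , refl) = node t u , ++⁺ t↭ u↭ , refl

  rearrange : ∀ {xs ys a b} → xs ↭ ys → a ≡ b → Product xs a → Product ys b
  rearrange xs↭ys refl (t , t↭ , refl) = t , ↭-trans t↭ xs↭ys , refl

-- The loop on {e} ∪ ℤ/m in which translations of ℤ/m are automorphisms; in
-- Fin (suc m), e is zero and the residue x is suc x.  ρ tabulates the row of
-- the residue 0, so that x · y is the translate by x of ρ (y - x).
module Translation (m : ℕ) .{{_ : NonZero m}} (ρ : Fin m → Fin (suc m)) where
  open Residues m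

  translate : ℤ → Fin (suc m) → Fin (suc m)
  translate i zero    = zero
  translate i (suc z) = suc [ i + ι z ]

  -- The product of the residues `-d` and 0, that is, the column of the residue 0. Right
  -- cancellation reduces to it as left cancellation reduces to `ρ`.
  column : Fin m → Fin (suc m)
  column d = translate (- ι d) (ρ d)

  translate-injective : ∀ i {v w} → translate i v ≡ translate i w → v ≡ w
  translate-injective i {zero}  {zero}  _  = refl
  translate-injective i {suc v} {suc w} eq =
    cong suc (ι-injective (+-cancelˡ i ([]-injective (suc-injective eq))))

  translate-cong : ∀ {i j} → i ≈ j → ∀ v → translate i v ≡ translate j v
  translate-cong i≈j zero    = refl
  translate-cong i≈j (suc v) = cong suc ([]-cong (+-cong i≈j ≈-refl))

  translate-+ : ∀ i j v → translate i (translate j v) ≡ translate (i + j) v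
  translate-+ i j zero    = refl
  translate-+ i j (suc v) = cong suc ([]-cong (≈-trans (+-cong (≈-refl {i}) (ι[] (j + ι v)))
    (≈-reflexive (sym (ℤ.+-assoc i j (ι v))))))

  translate-0 : ∀ i → translate i (suc [ 0ℤ ]) ≡ suc [ i ]
  translate-0 i = cong suc ([]-cong (≈-trans (+-cong (≈-refl {i}) (ι[] 0ℤ))
    (≈-reflexive (ℤ.+-identityʳ i))))

  infixl 7 _·_
  _·_ : Fin (suc m) → Fin (suc m) → Fin (suc m)
  zero  · y     = y
  suc x · zero  = suc x
  suc x · suc y = translate (ι x) (ρ [ ι y - ι x ])

  ·-row : ∀ i j → suc [ i ] · suc [ j ] ≡ translate i (ρ [ j - i ])
  ·-row i j = trans (cong (translate (ι [ i ]) ∘ ρ) ([]-cong (+-cong (ι[] j) (neg-cong (ι[] i)))))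
                    (translate-cong (ι[] i) _)

  ·-column : ∀ x y → suc x · suc y ≡ translate (ι y) (column [ ι y - ι x ])
  ·-column x y = sym (trans (translate-+ (ι y) _ _) (translate-cong (begin
    ι y - ι [ ι y - ι x ]   ≈⟨ +-cong (≈-refl {ι y}) (neg-cong {j = ι y - ι x} (ι[] _)) ⟩
    ι y - (ι y - ι x)       ≈⟨ ≈-reflexive (lemma (ι y) (ι x)) ⟩
    ι x                     ∎) _))
    where
    open ≈-Reasoning ≈-setoid
    lemma : ∀ y x → y - (y - x) ≡ x
    lemma = solve-∀

  -- The row and the column of the residue 0 already contain 0, in the place belonging to `e`; the
  -- remaining `m` entries therefore have to be distinct and avoid 0. Translation carries this to
  -- every other row and column.
  module Cancellative
    (ρ-injective : ∀ {d d′} → ρ d ≡ ρ d′ → d ≡ d′)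
    (ρ≢0 : ∀ d → ρ d ≢ suc [ 0ℤ ])
    (column-injective : ∀ {d d′} → column d ≡ column d′ → d ≡ d′)
    (column≢0 : ∀ d → column d ≢ suc [ 0ℤ ])
    where

    private
      ≢translate : ∀ x {v} → v ≢ suc [ 0ℤ ] → suc x ≢ translate (ι x) v
      ≢translate x v≢0 eq = v≢0 (translate-injective (ι x)
        (trans (sym eq) (sym (trans (translate-0 (ι x)) (cong suc ([ι] x))))))

      cancelˡ : ∀ a {x y} → a · x ≡ a · y → x ≡ y
      cancelˡ zero    eq = eq
      cancelˡ (suc a) {zero}  {zero}  eq = refl
      cancelˡ (suc a) {zero}  {suc y} eq = contradiction eq (≢translate a (ρ≢0 _))
      cancelˡ (suc a) {suc x} {zero}  eq = contradiction (sym eq) (≢translate a (ρ≢0 _))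
      cancelˡ (suc a) {suc x} {suc y} eq = cong suc (ι-injective (≈-by (ι x) (ι y) 1ℤ
        (lemma (ι x) (ι y) (ι a))
        ([]-injective {ι x - ι a} {ι y - ι a} (ρ-injective (translate-injective (ι a) eq)))))
        where
        lemma : ∀ x y a → x - y ≡ 1ℤ * ((x - a) - (y - a))
        lemma = solve-∀

      cancelʳ : ∀ a {x y} → x · a ≡ y · a → x ≡ y
      cancelʳ zero    {zero}  {zero}  eq = refl
      cancelʳ zero    {suc x} {suc y} eq = eq
      cancelʳ (suc a) {zero}  {zero}  eq = refl
      cancelʳ (suc a) {zero}  {suc y} eq =
        contradiction (trans eq (·-column y a)) (≢translate a (column≢0 _))
      cancelʳ (suc a) {suc x} {zero}  eq =
        contradiction (trans (sym eq) (·-column x a)) (≢translate a (column≢0 _))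
      cancelʳ (suc a) {suc x} {suc y} eq = cong suc (ι-injective (≈-by (ι x) (ι y) (- 1ℤ)
        (lemma (ι x) (ι y) (ι a))
        ([]-injective {ι a - ι x} {ι a - ι y} (column-injective (translate-injective (ι a)
          (trans (sym (·-column x a)) (trans eq (·-column y a))))))))
        where
        lemma : ∀ x y a → x - y ≡ - 1ℤ * ((a - x) - (a - y))
        lemma = solve-∀

      identityʳ : ∀ x → x · zero ≡ x
      identityʳ zero    = refl
      identityʳ (suc x) = refl

    loop : Loop (suc m)
    loop = cancellativeLoop _·_ zero cancelˡ cancelʳ (λ _ → refl) identityʳ

    open Products loop public

    -- The neutral element is included among the factors from the start. It is thus used exactly
    -- once, and the empty list of residues has product `e`.
    PartialProduct : List (Fin m) → Fin (suc m) → Set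
    PartialProduct xs = Product (zero ∷ map suc xs)

    empty : PartialProduct [] zero
    empty = single zero

    infixr 6 _◁_
    _◁_ : ∀ {xs ys a b} → Product (map suc xs) a → PartialProduct ys b →
          PartialProduct (xs ++ ys) (a · b)
    _◁_ {xs} {ys} p q = rearrange
      (↭-trans (shift zero (map suc xs) (map suc ys))
        (prep zero (↭-reflexive (sym (map-++ suc xs ys))))) refl (p ⊙ q)

    partialProduct⇒InP : ∀ s {q} → PartialProduct (segment s m) q → InP loop q
    partialProduct⇒InP s = rearrange (begin
      zero ∷ map suc (segment s m)  ↭⟨ prep zero (map⁺ suc (segment↭allFin s)) ⟩
      zero ∷ map suc (allFin m)     ≡⟨ cong (zero ∷_) (map-tabulate id suc) ⟩
      allFin (suc m)                ∎) refl
      where open PermutationReasoning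

    -- For every `s` the segment of length `m` from `s` lists all residues, so one recipe with value
    -- `s + κ` reaches every residue as `s` varies.
    PIsWhole-by : PartialProduct (segment 0ℤ m) zero →
      (κ : ℤ) → (∀ s → PartialProduct (segment s m) (suc [ s + κ ])) → PIsWhole loop
    PIsWhole-by e∈P κ s+κ∈P zero    = partialProduct⇒InP 0ℤ e∈P
    PIsWhole-by e∈P κ s+κ∈P (suc x) = partialProduct⇒InP (ι x - κ)
      (rearrange ↭-refl
        (cong suc (trans ([]-cong (≈-reflexive (lemma (ι x) κ))) ([ι] x)))
        (s+κ∈P (ι x - κ)))
      where
      lemma : ∀ x κ → x - κ + κ ≡ x
      lemma = solve-∀

-- Odd m

-- x · y = (x + y) / 2 for distinct residues x, y, and x · x = e.
module Midpoint (k : ℕ) (2≤k : 2 ≤ k) where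

  m : ℕ
  m = suc (k ℕ.+ k)

  open Residues m

  -- The inverse of 2 modulo `m = 2k + 1`.
  h : ℤ
  h = 1ℤ + + k

  h+h≈1 : h + h ≈ 1ℤ
  h+h≈1 = ≈-by (h + h) 1ℤ 1ℤ (lemma (+ k)) modulus≈0
    where
    lemma : ∀ k → ((1ℤ + k) + (1ℤ + k)) - 1ℤ ≡ 1ℤ * ((1ℤ + (k + k)) - 0ℤ)
    lemma = solve-∀

  half-injective : ∀ {a b} → h * a ≈ h * b → a ≈ b
  half-injective {a} {b} ha≈hb = begin
    a             ≈⟨ double a ⟨
    + 2 * (h * a) ≈⟨ *-congˡ (+ 2) ha≈hb ⟩
    + 2 * (h * b) ≈⟨ double b ⟩
    b             ∎
    where
    open ≈-Reasoning ≈-setoid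
    lemma : ∀ h a → + 2 * (h * a) - a ≡ a * ((h + h) - 1ℤ)
    lemma = solve-∀
    double : ∀ a → + 2 * (h * a) ≈ a
    double a = ≈-by (+ 2 * (h * a)) a a (lemma h a) h+h≈1

  half-0 : ∀ {a} → h * a ≈ 0ℤ → a ≈ 0ℤ
  half-0 ha≈0 = half-injective (≈-trans ha≈0 (≈-reflexive (sym (ℤ.*-zeroʳ h))))

  ι≈0 : ∀ {d} → ι d ≈ 0ℤ → d ≡ [ 0ℤ ]
  ι≈0 {d} ιd≈0 = trans (sym ([ι] d)) ([]-cong ιd≈0)

  ρ : Fin m → Fin (suc m)
  ρ d with d ≟ [ 0ℤ ]
  ... | yes _ = zero
  ... | no  _ = suc [ h * ι d ]

  open Translation m ρ

  -- Since `h - 1` is congruent to `-h`, the column is the negative of the row, and its injectivity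
  -- follows from that of halving.
  column≈ : ∀ d → - ι d + ι [ h * ι d ] ≈ - (h * ι d)
  column≈ d = begin
    - ι d + ι [ h * ι d ] ≈⟨ +-cong (≈-refl { - ι d }) (ι[] (h * ι d)) ⟩
    - ι d + h * ι d       ≈⟨ ≈-by _ _ (ι d) (lemma h (ι d)) h+h≈1 ⟩
    - (h * ι d)           ∎
    where
    open ≈-Reasoning ≈-setoid
    lemma : ∀ h d → (- d + h * d) - (- (h * d)) ≡ d * ((h + h) - 1ℤ)
    lemma = solve-∀

  neg-injective : ∀ {i j} → - i ≈ - j → i ≈ j
  neg-injective {i} {j} = ≈-by i j (- 1ℤ) (lemma i j)
    where
    lemma : ∀ i j → i - j ≡ - 1ℤ * (- i - - j)
    lemma = solve-∀

  ρ-injective : ∀ {d d′} → ρ d ≡ ρ d′ → d ≡ d′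
  ρ-injective {d} {d′} eq with d ≟ [ 0ℤ ] | d′ ≟ [ 0ℤ ]
  ... | yes p | yes q = trans p (sym q)
  ... | no  _ | no  _ = ι-injective (half-injective ([]-injective (suc-injective eq)))

  ρ≢0 : ∀ d → ρ d ≢ suc [ 0ℤ ]
  ρ≢0 d eq with d ≟ [ 0ℤ ]
  ... | no d≢0 = d≢0 (ι≈0 (half-0 ([]-injective (suc-injective eq))))

  column-injective : ∀ {d d′} → column d ≡ column d′ → d ≡ d′
  column-injective {d} {d′} eq with d ≟ [ 0ℤ ] | d′ ≟ [ 0ℤ ]
  ... | yes p | yes q = trans p (sym q)
  ... | no  _ | no  _ = ι-injective (half-injective (neg-injective (begin
      - (h * ι d)              ≈⟨ column≈ d ⟨
      - ι d + ι [ h * ι d ]    ≈⟨ []-injective (suc-injective eq) ⟩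
      - ι d′ + ι [ h * ι d′ ]  ≈⟨ column≈ d′ ⟩
      - (h * ι d′)             ∎)))
    where open ≈-Reasoning ≈-setoid

  column≢0 : ∀ d → column d ≢ suc [ 0ℤ ]
  column≢0 d eq with d ≟ [ 0ℤ ]
  ... | no d≢0 = d≢0 (ι≈0 (half-0 (neg-injective
        (≈-trans (≈-sym (column≈ d)) ([]-injective (suc-injective eq))))))

  open Cancellative ρ-injective ρ≢0 column-injective column≢0

  ·-same : ∀ i j → i ≈ j → suc [ i ] · suc [ j ] ≡ zero
  ·-same i j i≈j = trans (·-row i j) (cong (translate i) ρ≡zero)
    where
    lemma : ∀ i j → (j - i) - 0ℤ ≡ - 1ℤ * (i - j)
    lemma = solve-∀
    ρ≡zero : ρ [ j - i ] ≡ zero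
    ρ≡zero with [ j - i ] ≟ [ 0ℤ ]
    ... | yes _  = refl
    ... | no  ≢0 = contradiction ([]-cong (≈-by (j - i) 0ℤ (- 1ℤ) (lemma i j) i≈j)) ≢0

  -- The free `v` lets each use state the midpoint in a convenient form, checked by the ring solver.
  ·-distinct : ∀ i j v → ¬ i ≈ j → i + h * (j - i) ≡ v → suc [ i ] · suc [ j ] ≡ suc [ v ]
  ·-distinct i j v i≉j refl = trans (·-row i j) (trans (cong (translate i) ρ≡)
    (cong suc ([]-cong (+-cong (≈-refl {i}) (≈-trans (ι[] _) (*-congˡ h (ι[] (j - i))))))))
    where
    lemma : ∀ i j → i - j ≡ - 1ℤ * ((j - i) - 0ℤ)
    lemma = solve-∀
    ρ≡ : ρ [ j - i ] ≡ suc [ h * ι [ j - i ] ]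
    ρ≡ with [ j - i ] ≟ [ 0ℤ ]
    ... | yes ≡0 = contradiction (≈-by i j (- 1ℤ) (lemma i j) ([]-injective ≡0)) i≉j
    ... | no  _  = refl

  4<m : 4 < m
  4<m = s≤s (ℕ.+-mono-≤ 2≤k 2≤k)

  1<m : 1 < m
  1<m = ℕ.≤-trans (s≤s (s≤s z≤n)) 4<m

  2<m : 2 < m
  2<m = ℕ.≤-trans (s≤s (s≤s (s≤s z≤n))) 4<m

  3<m : 3 < m
  3<m = ℕ.<-trans (s≤s (s≤s (s≤s (s≤s z≤n)))) 4<m

  -- s and s + 3 have the same midpoint as s + 1 and s + 2.
  quadruple : ∀ s → Product (map suc (segment s 4)) zero
  quadruple s = rearrange (prep _ (↭-sym (shift (suc [ s₃ ]) (suc [ s₁ ] ∷ suc [ s₂ ] ∷ []) []))) s₀s₃·s₁s₂≡e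
    ((single (suc [ s₀ ]) ⊙ single (suc [ s₃ ])) ⊙ (single (suc [ s₁ ]) ⊙ single (suc [ s₂ ])))
    where
    s₀ = s
    s₁ = s + 1ℤ
    s₂ = s + 1ℤ + 1ℤ
    s₃ = s + 1ℤ + 1ℤ + 1ℤ
    d₀₃ : ∀ s → (s + 1ℤ + 1ℤ + 1ℤ) - s ≡ + 3
    d₀₃ = solve-∀
    d₁₂ : ∀ s → (s + 1ℤ + 1ℤ) - (s + 1ℤ) ≡ + 1
    d₁₂ = solve-∀
    v₀₃ : ∀ s h → s + h * ((s + 1ℤ + 1ℤ + 1ℤ) - s) ≡ s + h * + 3
    v₀₃ = solve-∀
    v₁₂ : ∀ s h → (s + 1ℤ) + h * ((s + 1ℤ + 1ℤ) - (s + 1ℤ)) ≡ s + 1ℤ + h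
    v₁₂ = solve-∀
    same : ∀ s h → (s + h * + 3) - (s + 1ℤ + h) ≡ 1ℤ * (h + h - 1ℤ)
    same = solve-∀
    s₀s₃·s₁s₂≡e : (suc [ s₀ ] · suc [ s₃ ]) · (suc [ s₁ ] · suc [ s₂ ]) ≡ zero
    s₀s₃·s₁s₂≡e = trans
      (cong₂ _·_ (·-distinct s₀ s₃ _ (≉-by 2 (d₀₃ s) 3<m) (v₀₃ s h))
                 (·-distinct s₁ s₂ _ (≉-by 0 (d₁₂ s) 1<m) (v₁₂ s h)))
      (·-same _ _ (≈-by _ _ 1ℤ (same s h) h+h≈1))

  -- The pairs `s`, `s + 3` and `s + 1`, `s + 4` have midpoints `s + 3/2` and `s + 5/2`. The
  -- midpoint of these is `s + 2`, whose product with the remaining factor `s + 2` is `e`.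
  quintuple : ∀ s → Product (map suc (segment s 5)) zero
  quintuple s = rearrange reorder product≡e
    (((single (suc [ s₀ ]) ⊙ single (suc [ s₃ ])) ⊙ (single (suc [ s₁ ]) ⊙ single (suc [ s₄ ])))
      ⊙ single (suc [ s₂ ]))
    where
    s₀ = s
    s₁ = s + 1ℤ
    s₂ = s + 1ℤ + 1ℤ
    s₃ = s + 1ℤ + 1ℤ + 1ℤ
    s₄ = s + 1ℤ + 1ℤ + 1ℤ + 1ℤ
    reorder : suc [ s₀ ] ∷ suc [ s₃ ] ∷ suc [ s₁ ] ∷ suc [ s₄ ] ∷ suc [ s₂ ] ∷ []
            ↭ map suc (segment s 5)
    reorder = prep _ (↭-trans (swap _ _ (swap _ _ ↭-refl)) (prep _ (swap-right)))
      where
      swap-right : suc [ s₃ ] ∷ suc [ s₂ ] ∷ suc [ s₄ ] ∷ []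
                 ↭ suc [ s₂ ] ∷ suc [ s₃ ] ∷ suc [ s₄ ] ∷ []
      swap-right = swap _ _ ↭-refl
    d₀₃ : ∀ s → (s + 1ℤ + 1ℤ + 1ℤ) - s ≡ + 3
    d₀₃ = solve-∀
    d₁₄ : ∀ s → (s + 1ℤ + 1ℤ + 1ℤ + 1ℤ) - (s + 1ℤ) ≡ + 3
    d₁₄ = solve-∀
    dᵥ : ∀ s h → (s + 1ℤ + h * + 3) - (s + h * + 3) ≡ + 1
    dᵥ = solve-∀
    v₀₃ : ∀ s h → s + h * ((s + 1ℤ + 1ℤ + 1ℤ) - s) ≡ s + h * + 3
    v₀₃ = solve-∀
    v₁₄ : ∀ s h → (s + 1ℤ) + h * ((s + 1ℤ + 1ℤ + 1ℤ + 1ℤ) - (s + 1ℤ)) ≡ s + 1ℤ + h * + 3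
    v₁₄ = solve-∀
    vᵥ : ∀ s h → (s + h * + 3) + h * ((s + 1ℤ + h * + 3) - (s + h * + 3)) ≡ s + h * + 4
    vᵥ = solve-∀
    same : ∀ s h → (s + h * + 4) - (s + 1ℤ + 1ℤ) ≡ + 2 * (h + h - 1ℤ)
    same = solve-∀
    product≡e : ((suc [ s₀ ] · suc [ s₃ ]) · (suc [ s₁ ] · suc [ s₄ ])) · suc [ s₂ ] ≡ zero
    product≡e = trans
      (cong (_· suc [ s₂ ]) (trans
        (cong₂ _·_ (·-distinct s₀ s₃ _ (≉-by 2 (d₀₃ s) 3<m) (v₀₃ s h))
                   (·-distinct s₁ s₄ _ (≉-by 2 (d₁₄ s) 3<m) (v₁₄ s h)))
        (·-distinct _ _ _ (≉-by 0 (dᵥ s h) 1<m) (vᵥ s h))))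
      (·-same _ _ (≈-by _ _ (+ 2) (same s h) h+h≈1))

  -- The midpoint of `s` and `s + 2` is the remaining factor `s + 1`.
  triple : ∀ s → Product (map suc (segment s 3)) zero
  triple s = rearrange (prep _ (swap _ _ ↭-refl)) product≡e
    ((single (suc [ s₀ ]) ⊙ single (suc [ s₂ ])) ⊙ single (suc [ s₁ ]))
    where
    s₀ = s
    s₁ = s + 1ℤ
    s₂ = s + 1ℤ + 1ℤ
    d₀₂ : ∀ s → (s + 1ℤ + 1ℤ) - s ≡ + 2
    d₀₂ = solve-∀
    v₀₂ : ∀ s h → s + h * ((s + 1ℤ + 1ℤ) - s) ≡ s + h * + 2
    v₀₂ = solve-∀
    same : ∀ s h → (s + h * + 2) - (s + 1ℤ) ≡ 1ℤ * (h + h - 1ℤ)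
    same = solve-∀
    product≡e : (suc [ s₀ ] · suc [ s₂ ]) · suc [ s₁ ] ≡ zero
    product≡e = trans
      (cong (_· suc [ s₁ ]) (·-distinct s₀ s₂ _ (≉-by 1 (d₀₂ s) 2<m) (v₀₂ s h)))
      (·-same _ _ (≈-by _ _ 1ℤ (same s h) h+h≈1))

  -- The residue 5/4: the midpoint of `s + 1/2` and `s + 2` is `s + 5/4`.
  κ₃ : ℤ
  κ₃ = h * + 3 - h * h

  triple′ : ∀ s → Product (map suc (segment s 3)) (suc [ s + κ₃ ])
  triple′ s = rearrange ↭-refl product≡
    ((single (suc [ s₀ ]) ⊙ single (suc [ s₁ ])) ⊙ single (suc [ s₂ ]))
    where
    s₀ = s
    s₁ = s + 1ℤ
    s₂ = s + 1ℤ + 1ℤ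
    d₀₁ : ∀ s → (s + 1ℤ) - s ≡ + 1
    d₀₁ = solve-∀
    v₀₁ : ∀ s h → s + h * ((s + 1ℤ) - s) ≡ s + h
    v₀₁ = solve-∀
    v : ∀ s h → (s + h) + h * ((s + 1ℤ + 1ℤ) - (s + h)) ≡ s + (h * + 3 - h * h)
    v = solve-∀
    d : ∀ s → (s + 1ℤ + 1ℤ + 1ℤ) - s ≡ + 3
    d = solve-∀
    s+h≉s₂ : ¬ s + h ≈ s₂
    -- Doubling `s + 1/2 = s + 2` would make `s` congruent to `s + 3`, impossible as `m` exceeds 3.
    s+h≉s₂ p = ≉-by {s} 2 (d s) 3<m
      (≈-trans (≈-by _ _ 1ℤ (lemma₁ s h) (+-cong p p)) (≈-by _ _ (- 1ℤ) (lemma₂ s h) h+h≈1))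
      where
      lemma₁ : ∀ s h → s - (s + 1ℤ + 1ℤ + 1ℤ + 1ℤ - (h + h)) ≡ 1ℤ * ((s + h + (s + h)) - (s + 1ℤ + 1ℤ + (s + 1ℤ + 1ℤ)))
      lemma₁ = solve-∀
      lemma₂ : ∀ s h → (s + 1ℤ + 1ℤ + 1ℤ + 1ℤ - (h + h)) - (s + 1ℤ + 1ℤ + 1ℤ) ≡ - 1ℤ * (h + h - 1ℤ)
      lemma₂ = solve-∀
    product≡ : (suc [ s₀ ] · suc [ s₁ ]) · suc [ s₂ ] ≡ suc [ s + κ₃ ]
    product≡ = trans
      (cong (_· suc [ s₂ ]) (·-distinct s₀ s₁ _ (≉-by 0 (d₀₁ s) 1<m) (v₀₁ s h)))
      (·-distinct _ _ _ s+h≉s₂ (v s h))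

  quadruples : ∀ s j → PartialProduct (segment s (j ℕ.* 4)) zero
  quadruples s zero    = empty
  quadruples s (suc j) = quadruple s ◁ quadruples (s + 1ℤ + 1ℤ + 1ℤ + 1ℤ) j

  -- The quadruples contribute only `e`, so the value of the leading block survives.
  withQuadruples : ∀ s l j {q} → Product (map suc (segment s l)) q →
    PartialProduct (segment s (l ℕ.+ j ℕ.* 4)) q
  withQuadruples s l j {q} p =
    subst₂ PartialProduct (sym (segment-++ s l (j ℕ.* 4))) (Loop.identityʳ loop q)
      (p ◁ quadruples (s + + l) j)

  resize : ∀ {l} → m ≡ l → ∀ s {q} → PartialProduct (segment s l) q → PartialProduct (segment s m) q
  resize refl s p = p

  -- For `e`, a block of five is followed by `j` quadruples. For the residue `s`, the single factor
  -- `s` is followed by `suc j` quadruples, whence the offset 0.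
  PIsWhole-1mod4 : ∀ j → m ≡ 5 ℕ.+ j ℕ.* 4 → PIsWhole loop
  PIsWhole-1mod4 j m≡ = PIsWhole-by
    (resize m≡ 0ℤ (withQuadruples 0ℤ 5 j (quintuple 0ℤ)))
    0ℤ
    (λ s → resize m≡ s (withQuadruples s 1 (suc j)
      (rearrange ↭-refl (cong (suc ∘ [_]) (sym (ℤ.+-identityʳ s))) (single (suc [ s ])))))

  -- As `7 + 4j = 3 + 4(j + 1)`, both values come from a leading block of three, multiplied in two
  -- different ways.
  PIsWhole-3mod4 : ∀ j → m ≡ 7 ℕ.+ j ℕ.* 4 → PIsWhole loop
  PIsWhole-3mod4 j m≡ = PIsWhole-by
    (resize m≡ 0ℤ (withQuadruples 0ℤ 3 (suc j) (triple 0ℤ)))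
    κ₃
    (λ s → resize m≡ s (withQuadruples s 3 (suc j) (triple′ s)))

-- Even m

module Antipodal (b : ℕ) where

  c m : ℕ
  c = 3 ℕ.+ b
  m = 2 ℕ.* c

  open Residues m

  +m≡2c : + m ≡ + 2 * + c
  +m≡2c = ℤ.pos-* 2 c

  2c≈0 : + 2 * + c ≈ 0ℤ
  2c≈0 = ≈-trans (≈-reflexive (sym +m≡2c)) modulus≈0

  -- The first half of the row runs through the odd residues 1, 3, ..., `2c - 1`, the second through
  -- the nonzero even residues. Writing `2(d - c)` for `2d` keeps all values below `m`, so that
  -- injectivity can be checked on naturals, with parity separating the halves.
  ρ : Fin m → Fin (suc m)
  ρ d with ℕ.<-cmp (toℕ d) c
  ... | tri< _ _ _ = suc [ + suc (2 ℕ.* toℕ d) ]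
  ... | tri≈ _ _ _ = zero
  ... | tri> _ _ _ = suc [ + (2 ℕ.* (toℕ d ℕ.∸ c)) ]

  open Translation m ρ

  2k+1<m : ∀ {k} → k < c → suc (2 ℕ.* k) < m
  2k+1<m {k} k<c = subst (ℕ._≤ m) (ℕ.*-suc 2 k) (ℕ.*-monoʳ-≤ 2 k<c)

  k+1<m : ∀ {k} → k < c → suc k < m
  k+1<m {k} k<c = ℕ.≤-<-trans (s≤s (ℕ.m≤m+n k _)) (2k+1<m k<c)

  k∸c<c : ∀ {k} → c < k → k < m → k ℕ.∸ c < c
  k∸c<c {k} c<k k<m = ℕ.+-cancelˡ-< c _ _ (begin-strict
    c ℕ.+ (k ℕ.∸ c) ≡⟨ ℕ.m+[n∸m]≡n (ℕ.<⇒≤ c<k) ⟩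
    k               <⟨ k<m ⟩
    c ℕ.+ (c ℕ.+ 0) ≡⟨ cong (c ℕ.+_) (ℕ.+-identityʳ c) ⟩
    c ℕ.+ c         ∎)
    where open ℕ.≤-Reasoning

  2[k∸c]<m : ∀ {k} → c < k → k < m → 2 ℕ.* (k ℕ.∸ c) < m
  2[k∸c]<m c<k k<m = ℕ.*-monoʳ-< 2 (k∸c<c c<k k<m)

  0<m : 0 < m
  0<m = s≤s z≤n

  []-injective-< : ∀ {i j} → i < m → j < m → suc [ + i ] ≡ suc [ + j ] → i ≡ j
  []-injective-< i<m j<m eq = +-injective-≈ i<m j<m ([]-injective (suc-injective eq))

  ρ-injective : ∀ {d d′} → ρ d ≡ ρ d′ → d ≡ d′
  ρ-injective {d} {d′} eq with ℕ.<-cmp (toℕ d) c | ℕ.<-cmp (toℕ d′) c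
  ... | tri< d<c _ _ | tri< d′<c _ _ = toℕ-injective (ℕ.*-cancelˡ-≡ _ _ 2
        (ℕ.suc-injective ([]-injective-< (2k+1<m d<c) (2k+1<m d′<c) eq)))
  ... | tri< d<c _ _ | tri> _ _ c<d′ = contradiction
        (sym ([]-injective-< (2k+1<m d<c) (2[k∸c]<m c<d′ (toℕ<n d′)) eq)) (ℕ.even≢odd (toℕ d′ ℕ.∸ c) (toℕ d))
  ... | tri≈ _ d≡c _ | tri≈ _ d′≡c _ = toℕ-injective (trans d≡c (sym d′≡c))
  ... | tri> _ _ c<d | tri< d′<c _ _ = contradiction
        ([]-injective-< (2[k∸c]<m c<d (toℕ<n d)) (2k+1<m d′<c) eq) (ℕ.even≢odd (toℕ d ℕ.∸ c) (toℕ d′))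
  ... | tri> _ _ c<d | tri> _ _ c<d′ = toℕ-injective (ℕ.∸-cancelʳ-≡ (ℕ.<⇒≤ c<d) (ℕ.<⇒≤ c<d′)
        (ℕ.*-cancelˡ-≡ _ _ 2
          ([]-injective-< (2[k∸c]<m c<d (toℕ<n d)) (2[k∸c]<m c<d′ (toℕ<n d′)) eq)))

  ρ≢0 : ∀ d → ρ d ≢ suc [ 0ℤ ]
  ρ≢0 d eq with ℕ.<-cmp (toℕ d) c
  ... | tri< d<c _ _ = case []-injective-< (2k+1<m d<c) 0<m eq of λ ()
  ... | tri> _ _ c<d = ℕ.m<n⇒n≢0 (ℕ.m<n⇒0<n∸m c<d) (ℕ.*-cancelˡ-≡ _ _ 2
        ([]-injective-< (2[k∸c]<m c<d (toℕ<n d)) 0<m eq))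

  []-compare : ∀ {a b i j} → suc [ a ] ≡ suc [ b ] → a ≈ i → b ≈ j → i ≈ j
  []-compare eq a≈i b≈j =
    ≈-trans (≈-sym a≈i) (≈-trans ([]-injective (suc-injective eq)) b≈j)

  column-< : ∀ d → - ι d + ι [ + suc (2 ℕ.* toℕ d) ] ≈ + suc (toℕ d)
  column-< d = ≈-trans (+-cong (≈-refl { - ι d }) (ι[] _)) (≈-reflexive
    (trans (cong (λ x → - ι d + (1ℤ + x)) (ℤ.pos-* 2 (toℕ d))) (lemma (ι d))))
    where
    lemma : ∀ d → - d + (1ℤ + + 2 * d) ≡ 1ℤ + d
    lemma = solve-∀

  column-> : ∀ d → c < toℕ d → - ι d + ι [ + (2 ℕ.* (toℕ d ℕ.∸ c)) ] ≈ ι d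
  column-> d c<d = begin
    - ι d + ι [ + (2 ℕ.* a) ]         ≈⟨ +-cong (≈-refl { - ι d }) (ι[] _) ⟩
    - ι d + + (2 ℕ.* a)               ≡⟨ cong (_+_ (- ι d)) (ℤ.pos-* 2 a) ⟩
    - ι d + + 2 * + a                 ≡⟨ cong (λ x → - x + + 2 * + a) ιd≡ ⟨
    - (+ c + + a) + + 2 * + a         ≈⟨ ≈-by _ _ (- 1ℤ) (lemma (+ c) (+ a)) 2c≈0 ⟩
    + c + + a                         ≡⟨ ιd≡ ⟩
    ι d                               ∎
    where
    open ≈-Reasoning ≈-setoid
    a = toℕ d ℕ.∸ c
    ιd≡ : + c + + a ≡ ι d
    ιd≡ = cong +_ (ℕ.m+[n∸m]≡n (ℕ.<⇒≤ c<d))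
    lemma : ∀ c a → (- (c + a) + + 2 * a) - (c + a) ≡ - 1ℤ * (+ 2 * c - 0ℤ)
    lemma = solve-∀

  -- The column takes the values `d + 1` for `d < c`, which are 1, ..., `c`, then `e`, and then `d`
  -- for `d > c`, so no value repeats.
  column-injective : ∀ {d d′} → column d ≡ column d′ → d ≡ d′
  column-injective {d} {d′} eq with ℕ.<-cmp (toℕ d) c | ℕ.<-cmp (toℕ d′) c
  ... | tri< d<c _ _ | tri< d′<c _ _ = toℕ-injective (ℕ.suc-injective
        (+-injective-≈ (k+1<m d<c) (k+1<m d′<c) ([]-compare eq (column-< d) (column-< d′))))
  ... | tri< d<c _ _ | tri> _ _ c<d′ = contradiction
        (+-injective-≈ (k+1<m d<c) (toℕ<n d′) ([]-compare eq (column-< d) (column-> d′ c<d′)))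
        (ℕ.<⇒≢ (ℕ.≤-<-trans d<c c<d′))
  ... | tri≈ _ d≡c _ | tri≈ _ d′≡c _ = toℕ-injective (trans d≡c (sym d′≡c))
  ... | tri> _ _ c<d | tri< d′<c _ _ = contradiction
        (sym (+-injective-≈ (toℕ<n d) (k+1<m d′<c) ([]-compare eq (column-> d c<d) (column-< d′))))
        (ℕ.<⇒≢ (ℕ.≤-<-trans d′<c c<d))
  ... | tri> _ _ c<d | tri> _ _ c<d′ =
        ι-injective ([]-compare eq (column-> d c<d) (column-> d′ c<d′))

  column≢0 : ∀ d → column d ≢ suc [ 0ℤ ]
  column≢0 d eq with ℕ.<-cmp (toℕ d) c
  ... | tri< d<c _ _ = case +-injective-≈ (k+1<m d<c) 0<m
        ([]-compare eq (column-< d) ≈-refl) of λ ()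
  ... | tri> _ _ c<d = ℕ.m<n⇒n≢0 c<d (+-injective-≈ (toℕ<n d) 0<m
        ([]-compare eq (column-> d c<d) ≈-refl))

  open Cancellative ρ-injective ρ≢0 column-injective column≢0

  toℕ[] : ∀ {k} → k < m → toℕ [ + k ] ≡ k
  toℕ[] {k} k<m = +-injective-≈ (toℕ<n _) k<m (ι[] (+ k))

  ·-below : ∀ i j v k → k < c → j - i ≈ + k → i + (1ℤ + + 2 * + k) ≈ v →
    suc [ i ] · suc [ j ] ≡ suc [ v ]
  ·-below i j v k k<c j-i≈k i+2k+1≈v = begin
    suc [ i ] · suc [ j ]                          ≡⟨ ·-row i j ⟩
    translate i (ρ [ j - i ])                      ≡⟨ cong (translate i ∘ ρ) ([]-cong j-i≈k) ⟩
    translate i (ρ [ + k ])                        ≡⟨ cong (translate i) ρ≡ ⟩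
    suc [ i + ι [ + suc (2 ℕ.* toℕ [ + k ]) ] ]    ≡⟨ cong suc ([]-cong (+-cong (≈-refl {i}) (ι[] _))) ⟩
    suc [ i + + suc (2 ℕ.* toℕ [ + k ]) ]          ≡⟨ cong (λ k → suc [ i + + suc (2 ℕ.* k) ]) toℕk ⟩
    suc [ i + (1ℤ + + (2 ℕ.* k)) ]                 ≡⟨ cong (λ x → suc [ i + (1ℤ + x) ]) (ℤ.pos-* 2 k) ⟩
    suc [ i + (1ℤ + + 2 * + k) ]                   ≡⟨ cong suc ([]-cong i+2k+1≈v) ⟩
    suc [ v ]                                      ∎
    where
    open ≡-Reasoning
    toℕk : toℕ [ + k ] ≡ k
    toℕk = toℕ[] (ℕ.<-trans (ℕ.n<1+n k) (k+1<m k<c))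
    ρ≡ : ρ [ + k ] ≡ suc [ + suc (2 ℕ.* toℕ [ + k ]) ]
    ρ≡ with ℕ.<-cmp (toℕ [ + k ]) c
    ... | tri< _ _ _   = refl
    ... | tri≈ k≮c _ _ = contradiction (subst (_< c) (sym toℕk) k<c) k≮c
    ... | tri> k≮c _ _ = contradiction (subst (_< c) (sym toℕk) k<c) k≮c

  c<m : c < m
  c<m = ℕ.m<m+n c (s≤s z≤n)

  ·-antipodal : ∀ i j → j - i ≈ + c → suc [ i ] · suc [ j ] ≡ zero
  ·-antipodal i j j-i≈c = trans (·-row i j)
    (cong (translate i) (trans (cong ρ ([]-cong j-i≈c)) ρ≡))
    where
    ρ≡ : ρ [ + c ] ≡ zero
    ρ≡ with ℕ.<-cmp (toℕ [ + c ]) c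
    ... | tri< _ d≢c _  = contradiction (toℕ[] c<m) d≢c
    ... | tri≈ _ _ _    = refl
    ... | tri> _ d≢c _  = contradiction (toℕ[] c<m) d≢c

  ·-above : ∀ i j v a → 0 < a → a < c → j - i ≈ + c + + a → i + + 2 * + a ≈ v →
    suc [ i ] · suc [ j ] ≡ suc [ v ]
  ·-above i j v a 0<a a<c j-i≈c+a i+2a≈v = begin
    suc [ i ] · suc [ j ]                       ≡⟨ ·-row i j ⟩
    translate i (ρ [ j - i ])                   ≡⟨ cong (translate i ∘ ρ) ([]-cong j-i≈c+a) ⟩
    translate i (ρ d)                           ≡⟨ cong (translate i) ρ≡ ⟩
    suc [ i + ι [ + (2 ℕ.* (toℕ d ℕ.∸ c)) ] ]   ≡⟨ cong suc ([]-cong (+-cong (≈-refl {i}) (ι[] _))) ⟩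
    suc [ i + + (2 ℕ.* (toℕ d ℕ.∸ c)) ]         ≡⟨ cong (λ k → suc [ i + + (2 ℕ.* k) ]) d∸c≡a ⟩
    suc [ i + + (2 ℕ.* a) ]                     ≡⟨ cong (λ x → suc [ i + x ]) (ℤ.pos-* 2 a) ⟩
    suc [ i + + 2 * + a ]                       ≡⟨ cong suc ([]-cong i+2a≈v) ⟩
    suc [ v ]                                   ∎
    where
    open ≡-Reasoning
    d : Fin m
    d = [ + (c ℕ.+ a) ]
    toℕd : toℕ d ≡ c ℕ.+ a
    toℕd = toℕ[] (ℕ.+-monoʳ-< c (subst (a <_) (sym (ℕ.+-identityʳ c)) a<c))
    d∸c≡a : toℕ d ℕ.∸ c ≡ a
    d∸c≡a = trans (cong (ℕ._∸ c) toℕd) (ℕ.m+n∸m≡n c a)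
    c<d : c < toℕ d
    c<d = subst (c <_) (sym toℕd) (ℕ.m<m+n c 0<a)
    ρ≡ : ρ d ≡ suc [ + (2 ℕ.* (toℕ d ℕ.∸ c)) ]
    ρ≡ with ℕ.<-cmp (toℕ d) c
    ... | tri< _ _ d≯c  = contradiction c<d d≯c
    ... | tri≈ _ _ d≯c  = contradiction c<d d≯c
    ... | tri> _ _ _    = refl

  -- Lists each residue next to its antipode, since the product of such a pair is `e`.
  antipodes : ℤ → ℕ → List (Fin m)
  antipodes s zero    = []
  antipodes s (suc l) = [ s ] ∷ [ s + + c ] ∷ antipodes (s + 1ℤ) l

  antipodes↭ : ∀ s l → antipodes s l ↭ segment s l ++ segment (s + + c) l
  antipodes↭ s zero    = ↭-refl
  antipodes↭ s (suc l) = prep _ (begin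
    [ s + + c ] ∷ antipodes (s + 1ℤ) l
      ↭⟨ prep _ (antipodes↭ (s + 1ℤ) l) ⟩
    [ s + + c ] ∷ segment (s + 1ℤ) l ++ segment (s + 1ℤ + + c) l
      ↭⟨ shift _ (segment (s + 1ℤ) l) _ ⟨
    segment (s + 1ℤ) l ++ [ s + + c ] ∷ segment (s + 1ℤ + + c) l
      ≡⟨ cong (λ t → segment (s + 1ℤ) l ++ [ s + + c ] ∷ segment t l) (lemma s (+ c)) ⟩
    segment (s + 1ℤ) l ++ [ s + + c ] ∷ segment (s + + c + 1ℤ) l ∎)
    where
    open PermutationReasoning
    lemma : ∀ s c → s + 1ℤ + c ≡ s + c + 1ℤ
    lemma = solve-∀

  antipodes↭segment : ∀ s → antipodes s c ↭ segment s m
  antipodes↭segment s = begin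
    antipodes s c                       ↭⟨ antipodes↭ s c ⟩
    segment s c ++ segment (s + + c) c  ≡⟨ segment-++ s c c ⟨
    segment s (c ℕ.+ c)                 ≡⟨ cong (λ k → segment s (c ℕ.+ k)) (ℕ.+-identityʳ c) ⟨
    segment s m                         ∎
    where open PermutationReasoning

  antipodalProduct : ∀ s l → PartialProduct (antipodes s l) zero
  antipodalProduct s zero    = empty
  antipodalProduct s (suc l) =
    rearrange ↭-refl (·-antipodal s (s + + c) (≈-reflexive (lemma s (+ c))))
      (single (suc [ s ]) ⊙ single (suc [ s + + c ]))
    ◁ antipodalProduct (s + 1ℤ) l
    where
    lemma : ∀ s c → (s + c) - s ≡ c
    lemma = solve-∀

  -- Modulo `2c` the successive values are `(s + 1 + c) · (s + c) = s + c - 1`, where the difference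
  -- -1 counts as `c + (c - 1)`; then `(s + 1) · (s + c - 1) = s - 2`, with difference `c - 2`; and
  -- finally `(s - 2) · s = s + 3`.
  twoAntipodalPairs : ∀ s → Product (map suc (antipodes s 2)) (suc [ s + + 3 ])
  twoAntipodalPairs s = rearrange reorder product≡
    ((single (suc [ s₁ ]) ⊙ (single (suc [ s₁′ ]) ⊙ single (suc [ s₀′ ]))) ⊙ single (suc [ s ]))
    where
    s₁ s₀′ s₁′ : ℤ
    s₁  = s + 1ℤ
    s₀′ = s + + c
    s₁′ = s + 1ℤ + + c

    reorder : suc [ s₁ ] ∷ suc [ s₁′ ] ∷ suc [ s₀′ ] ∷ suc [ s ] ∷ []
            ↭ suc [ s ] ∷ suc [ s₀′ ] ∷ suc [ s₁ ] ∷ suc [ s₁′ ] ∷ []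
    reorder = ↭-trans
      (shift (suc [ s ]) (suc [ s₁ ] ∷ suc [ s₁′ ] ∷ suc [ s₀′ ] ∷ []) [])
      (prep _ (shift (suc [ s₀′ ]) (suc [ s₁ ] ∷ suc [ s₁′ ] ∷ []) []))

    d₁ : ∀ s b → ((s + (+ 3 + b)) - (s + 1ℤ + (+ 3 + b))) - ((+ 3 + b) + (+ 2 + b))
               ≡ - 1ℤ * (+ 2 * (+ 3 + b) - 0ℤ)
    d₁ = solve-∀
    v₁ : ∀ s b → ((s + 1ℤ + (+ 3 + b)) + + 2 * (+ 2 + b)) - (s + (+ 2 + b))
               ≡ 1ℤ * (+ 2 * (+ 3 + b) - 0ℤ)
    v₁ = solve-∀
    d₂ : ∀ s b → (s + (+ 2 + b)) - (s + 1ℤ) ≡ 1ℤ + b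
    d₂ = solve-∀
    v₂ : ∀ s b → ((s + 1ℤ) + (1ℤ + + 2 * (1ℤ + b))) - (s - + 2)
               ≡ 1ℤ * (+ 2 * (+ 3 + b) - 0ℤ)
    v₂ = solve-∀
    d₃ : ∀ s → s - (s - + 2) ≡ + 2
    d₃ = solve-∀
    v₃ : ∀ s → (s - + 2) + (1ℤ + + 2 * + 2) ≡ s + + 3
    v₃ = solve-∀

    product≡ : (suc [ s₁ ] · (suc [ s₁′ ] · suc [ s₀′ ])) · suc [ s ] ≡ suc [ s + + 3 ]
    product≡ = begin
      (suc [ s₁ ] · (suc [ s₁′ ] · suc [ s₀′ ])) · suc [ s ]
        ≡⟨ cong (λ x → (suc [ s₁ ] · x) · suc [ s ])
             (·-above s₁′ s₀′ (s + (+ 2 + + b)) (2 ℕ.+ b) (s≤s z≤n) ℕ.≤-refl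
               (≈-by _ _ (- 1ℤ) (d₁ s (+ b)) 2c≈0) (≈-by _ _ 1ℤ (v₁ s (+ b)) 2c≈0)) ⟩
      (suc [ s₁ ] · suc [ s + (+ 2 + + b) ]) · suc [ s ]
        ≡⟨ cong (_· suc [ s ])
             (·-below s₁ (s + (+ 2 + + b)) (s - + 2) (1 ℕ.+ b) (ℕ.n≤1+n _)
               (≈-reflexive (d₂ s (+ b))) (≈-by _ _ 1ℤ (v₂ s (+ b)) 2c≈0)) ⟩
      suc [ s - + 2 ] · suc [ s ]
        -- The difference 2 falls in the lower half of the row precisely because `c` is at least 3.
        ≡⟨ ·-below (s - + 2) s (s + + 3) 2 (s≤s (s≤s (s≤s z≤n)))
             (≈-reflexive (d₃ s)) (≈-reflexive (v₃ s)) ⟩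
      suc [ s + + 3 ] ∎
      where open ≡-Reasoning

  -- Multiplying all `c` pairs in the given order yields `e`. Multiplying the first two pairs
  -- differently yields `s + 3`, and the other `c - 2 = 1 + b` pairs leave it unchanged.
  antipodalLoop-PIsWhole : PIsWhole loop
  antipodalLoop-PIsWhole = PIsWhole-by
    (toSegment 0ℤ (antipodalProduct 0ℤ c))
    (+ 3)
    (λ s → toSegment s
      (twoAntipodalPairs s ◁ antipodalProduct (s + 1ℤ + 1ℤ) (1 ℕ.+ b)))
    where
    toSegment : ∀ s {q} → PartialProduct (antipodes s c) q → PartialProduct (segment s m) q
    toSegment s = rearrange (prep zero (map⁺ suc (antipodes↭segment s))) refl

-- Order 5

module OrderFive where

  cayleyTable : Table 5
  cayleyTable =
    (0F ∷ 1F ∷ 2F ∷ 3F ∷ 4F ∷ []) ∷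
    (1F ∷ 0F ∷ 3F ∷ 4F ∷ 2F ∷ []) ∷
    (2F ∷ 3F ∷ 4F ∷ 0F ∷ 1F ∷ []) ∷
    (3F ∷ 4F ∷ 1F ∷ 2F ∷ 0F ∷ []) ∷
    (4F ∷ 2F ∷ 0F ∷ 1F ∷ 3F ∷ []) ∷ []

  cayleyLoop : Loop 5
  cayleyLoop = cancellativeLoop (mul cayleyTable) 0F
    (λ a {x} {y} → toWitness {a? = all? λ a → all? λ x → all? λ y →
      (mul cayleyTable a x ≟ mul cayleyTable a y) →-dec (x ≟ y)} _ a x y)
    (λ a {x} {y} → toWitness {a? = all? λ a → all? λ x → all? λ y →
      (mul cayleyTable x a ≟ mul cayleyTable y a) →-dec (x ≟ y)} _ a x y)
    (toWitness {a? = all? λ x → mul cayleyTable 0F x ≟ x} _)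
    (toWitness {a? = all? λ x → mul cayleyTable x 0F ≟ x} _)

  -- The values 1, 2 and 3 arise from the natural order by changing the bracketing alone; for 0 and
  -- 4 two factors are exchanged as well.
  cayleyLoop-PIsWhole : PIsWhole cayleyLoop
  cayleyLoop-PIsWhole 0F = rearrange (prep 0F (swap 2F 1F (prep 3F (prep 4F ↭-refl)))) refl
    (single 0F ⊙ single 2F ⊙ (single 1F ⊙ single 3F) ⊙ single 4F)
    where open Products cayleyLoop
  cayleyLoop-PIsWhole 1F = rearrange ↭-refl refl
    (single 0F ⊙ ((single 1F ⊙ single 2F) ⊙ single 3F) ⊙ single 4F)
    where open Products cayleyLoop
  cayleyLoop-PIsWhole 2F = rearrange ↭-refl refl
    (single 0F ⊙ single 1F ⊙ (single 2F ⊙ single 3F) ⊙ single 4F)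
    where open Products cayleyLoop
  cayleyLoop-PIsWhole 3F = rearrange ↭-refl refl
    (single 0F ⊙ single 1F ⊙ single 2F ⊙ single 3F ⊙ single 4F)
    where open Products cayleyLoop
  cayleyLoop-PIsWhole 4F = rearrange (prep 0F (prep 1F (prep 2F (swap 4F 3F ↭-refl)))) refl
    (single 0F ⊙ single 1F ⊙ single 2F ⊙ single 4F ⊙ single 3F)
    where open Products cayleyLoop

-- Assembling the orders

WholeLoop : ℕ → Set
WholeLoop n = ∃ λ (Q : Loop n) → PIsWhole Q

wholeLoop-1 : WholeLoop 1
wholeLoop-1 = Q , λ { 0F → single 0F }
  where
  Q : Loop 1
  Q = cancellativeLoop (λ _ _ → 0F) 0F
    (λ { _ {0F} {0F} _ → refl }) (λ { _ {0F} {0F} _ → refl }) (λ { 0F → refl }) (λ { 0F → refl })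
  open Products Q

-- The index is `m = n - 1`, the number of residues. Odd numbers are split modulo 4 because the
-- segments are cut into blocks of four after a leading block.
data Shape : ℕ → Set where
  even : ∀ b → Shape (2 ℕ.* (3 ℕ.+ b))
  1mod4 : ∀ j → Shape (5 ℕ.+ j ℕ.* 4)
  3mod4 : ∀ j → Shape (7 ℕ.+ j ℕ.* 4)

-- m = 4 is excluded since the formula for even m then yields the cyclic group of order 5.
shape : ∀ k → Shape (5 ℕ.+ k)
shape 0 = 1mod4 0
shape 1 = even 0
shape 2 = 3mod4 0
shape 3 = even 1
shape (suc (suc (suc (suc k)))) = 4+ (shape k)
  where
  4+ : ∀ {m} → Shape m → Shape (4 ℕ.+ m)
  4+ (even b)  = subst Shape (lemma b) (even (2 ℕ.+ b))
    where
    lemma : ∀ b → 2 ℕ.* (3 ℕ.+ (2 ℕ.+ b)) ≡ 4 ℕ.+ 2 ℕ.* (3 ℕ.+ b)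
    lemma = ℕ-Solver.solve-∀
  4+ (1mod4 j) = 1mod4 (suc j)
  4+ (3mod4 j) = 3mod4 (suc j)

wholeLoop-shape : ∀ {m} → Shape m → WholeLoop (suc m)
wholeLoop-shape (even b)  = _ , Antipodal.antipodalLoop-PIsWhole b
wholeLoop-shape (1mod4 j) = subst (WholeLoop ∘ suc) (lemma j)
  (_ , Midpoint.PIsWhole-1mod4 (2 ℕ.+ j ℕ.* 2) (s≤s (s≤s z≤n)) j (lemma j))
  where
  lemma : ∀ j → suc ((2 ℕ.+ j ℕ.* 2) ℕ.+ (2 ℕ.+ j ℕ.* 2)) ≡ 5 ℕ.+ j ℕ.* 4
  lemma = ℕ-Solver.solve-∀
wholeLoop-shape (3mod4 j) = subst (WholeLoop ∘ suc) (lemma j)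
  (_ , Midpoint.PIsWhole-3mod4 (3 ℕ.+ j ℕ.* 2) (s≤s (s≤s z≤n)) j (lemma j))
  where
  lemma : ∀ j → suc ((3 ℕ.+ j ℕ.* 2) ℕ.+ (3 ℕ.+ j ℕ.* 2)) ≡ 7 ℕ.+ j ℕ.* 4
  lemma = ℕ-Solver.solve-∀

wholeLoop : ∀ n → n ≡ 1 ⊎ 5 ≤ n → WholeLoop n
wholeLoop _ (inj₁ refl) = wholeLoop-1
wholeLoop _ (inj₂ (s≤s (s≤s (s≤s (s≤s (s≤s (z≤n {zero}))))))) =
  OrderFive.cayleyLoop , OrderFive.cayleyLoop-PIsWhole
-- Here `n = 6 + k`, so there are `5 + k` residues besides `e`.
wholeLoop _ (inj₂ (s≤s (s≤s (s≤s (s≤s (s≤s (z≤n {suc k}))))))) = wholeLoop-shape (shape k)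

wholeLoop-order : ∀ n → 1 ≤ n → WholeLoop n → n ≡ 1 ⊎ 5 ≤ n
wholeLoop-order 1 _ _ = inj₁ refl
-- For orders 2, 3 and 4 the search over all tables is carried out by evaluation during type
-- checking.
wholeLoop-order 2 _ (Q , whole) =
  contradiction whole (abelian⇒¬PIsWhole (toWitness {a? = loopTablesAbelian? 2} _) Q)
wholeLoop-order 3 _ (Q , whole) =
  contradiction whole (abelian⇒¬PIsWhole (toWitness {a? = loopTablesAbelian? 3} _) Q)
wholeLoop-order 4 _ (Q , whole) =
  contradiction whole (abelian⇒¬PIsWhole (toWitness {a? = loopTablesAbelian? 4} _) Q)
wholeLoop-order (suc (suc (suc (suc (suc n))))) _ _ = inj₂ (s≤s (s≤s (s≤s (s≤s (s≤s z≤n)))))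

theorem3p2 : (n : ℕ) → 1 ≤ n →
    ((∃ λ (Q : Loop n) → PIsWhole Q) ⇔ (n ≡ 1 ⊎ 5 ≤ n))
theorem3p2 n 1≤n = mk⇔ (wholeLoop-order n 1≤n) (wholeLoop n)
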